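{- Allowing the quantified flow functions in $\mathrm{BFL}^\star$ to take real values changes its semantics. That is, there exist a flow network $N$ and a closed $\mathrm{BFL}^\star$ state formula $\varphi$ such that the truth value of $N\models\varphi$ under the integral semantics (flow quantifiers range over flow functions $f:E\to\mathbb{N}$) differs from its truth value under the real semantics (flow quantifiers range over flow functions $f:E\to\mathbb{R}_{\geq 0}$).
   Context: **Flow networks.** A flow network is $N=\langle AP,V,E,c,\rho,s,T\rangle$ (finite), where $AP$ is a set of atomic propositions, $V$ is a set of vertices, $s\in V$ is the source, $T\subseteq V\setminus\{s\}$ is a set of target vertices, $E\subseteq (V\setminus T)\times(V\setminus\{s\})$ is a set of directed edges, $c:E\to\mathbb{N}$ is a capacity function, and $\rho:V\to 2^{AP}$ labels vertices. All $t\in T$ are assumed reachable from $s$, and each vertex has at least one target reachable from it. Let $E^u$ and $E_u$ be the sets of edges entering and leaving $u$. A flow function is $f:E\to\mathbb{N}$ with $f(e)\le c(e)$ for all $e\in E$ and $\sum_{e\in E^v}f(e)=\sum_{e\in E_v}f(e)$ for all $v\in V\setminus(\{s\}\cup T)$. The flow in a vertex is $f(v)=\sum_{e\in E^v}f(e)$ for $v\neq s$ and $f(s)=\sum_{e\in E_s}f(e)$. Real-valued flow functions $f:E\to\mathbb{R}_{\ge 0}$ are defined by the same constraints. **Syntax of $\mathrm{BFL}^\star$.** State formulas: $p\in AP$; flow propositions $>\gamma$ and $\geq\gamma$ for $\gamma\in\mathbb{N}$; $\neg\varphi_1$, $\varphi_1\vee\varphi_2$ for state formulas $\varphi_1,\varphi_2$;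 $A\psi$ for a path formula $\psi$; $\mathcal{A}\varphi$ for a state formula $\varphi$ ($\mathcal{A}$ is the flow quantifier). Path formulas: state formulas; $\neg\psi_1$, $\psi_1\vee\psi_2$, $X\psi_1$, $\psi_1U\psi_2$ for path formulas $\psi_1,\psi_2$. A formula is closed if all its flow propositions are in the scope of a flow quantifier. **Semantics.** For $u\in V$, a target $u$-path is a finite path $v_0,\dots,v_k$ in $(V,E)$ with $v_0=u$, $v_k\in T$; $\pi^i$ denotes the suffix $v_i,\dots,v_k$. State formulas: $v,f\models p$ iff $p\in\rho(v)$; $v,f\models{>}\gamma$ iff $f(v)>\gamma$; $v,f\models{\geq}\gamma$ iff $f(v)\ge\gamma$; Boolean operators as usual; $v,f\models A\psi$ iff $\pi,f\models\psi$ for all target $v$-paths $\pi$; $v,f\models\mathcal{A}\varphi$ iff $v,f'\models\varphi$ for all flow functions $f'$. Path formulas, $\pi=v_0,\dots,v_k$: $\pi,f\models\varphi$ iff $v_0,f\models\varphi$ for a state formula $\varphi$; Boolean operators as usual; $\pi,f\models X\psi$ iff $k>0$ and $\pi^1,f\models\psi$; $\pi,f\models\psi_1U\psi_2$ iff there is $j\le k$ with $\pi^j,f\models\psi_2$ and $\pi^i,f\models\psi_1$ for all $0\le i<j$. For closed $\varphi$, $N\models\varphi$ iff $s\models\varphi$ (the flow function is irrelevant). In the integral semantics, $f'$ in the clause for $\mathcal{A}$ ranges over flow functions $E\to\mathbb{N}$; in the real semantics it ranges over flow functions $E\to\mathbb{R}_{\ge0}$. -}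

module Defs where

open import Level using (0ℓ)
open import Algebra.Bundles.Raw using (RawMonoid)
import Algebra.Definitions.RawMonoid as RawMonoidDefinitions
open import Data.Empty using (⊥)
open import Data.Fin as Fin using (Fin; zero; suc)
open import Data.Fin.Subset using (Subset; _∈_; _∉_)
open import Data.Fin.Subset.Properties using (_∈?_)
import Data.Integer as ℤ
open import Data.Nat as ℕ using (ℕ)
import Data.Nat.Properties as ℕ
open import Data.Product using (Σ; ∃; _×_; _,_; proj₁; proj₂)
open import Data.Rational as ℚ using (ℚ; 0ℚ; ½; _/_)
import Data.Rational.Properties as ℚ
open import Data.Rational.Solver using (module +-*-Solver)
open import Data.Sum using (_⊎_)
open import Data.Unit using (⊤)
open import Relation.Binary.Construct.Closure.ReflexiveTransitive using (Star)
open import Relation.Binary.PropositionalEquality using (_≡_; _≢_; refl; cong; subst; sym)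
open import Relation.Nullary using (¬_; yes; no)

------------------------------------------------------------------------
-- Real numbers, as Cauchy sequences of rationals. Two sequences represent
-- the same real when they are related by _≈ℝ_.

Eventually : (ℕ → Set) → Set
Eventually P = ∃ λ N → ∀ n → N ℕ.≤ n → P n

Cauchy : (ℕ → ℚ) → Set
Cauchy x = ∀ ε → 0ℚ ℚ.< ε →
  ∃ λ N → ∀ m n → N ℕ.≤ m → N ℕ.≤ n → ℚ.∣ x m ℚ.- x n ∣ ℚ.< ε

record ℝ : Set where
  constructor mkℝ
  field
    seq    : ℕ → ℚ
    cauchy : Cauchy seq

open ℝ public

infix 4 _≈ℝ_ _≤ℝ_ _<ℝ_

_≈ℝ_ : ℝ → ℝ → Set
x ≈ℝ y = ∀ ε → 0ℚ ℚ.< ε →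
  Eventually λ n → ℚ.∣ seq x n ℚ.- seq y n ∣ ℚ.< ε

_≤ℝ_ : ℝ → ℝ → Set
x ≤ℝ y = ∀ ε → 0ℚ ℚ.< ε →
  Eventually λ n → seq x n ℚ.< seq y n ℚ.+ ε

_<ℝ_ : ℝ → ℝ → Set
x <ℝ y = ∃ λ ε → 0ℚ ℚ.< ε ×
  Eventually (λ n → seq x n ℚ.+ ε ℚ.< seq y n)

private
  half-pos : ∀ {ε} → 0ℚ ℚ.< ε → 0ℚ ℚ.< ½ ℚ.* ε
  half-pos {ε} 0<ε = subst (ℚ._< ½ ℚ.* ε) (ℚ.*-zeroʳ ½) (ℚ.*-monoʳ-<-pos ½ 0<ε)

  half+half : ∀ ε → ½ ℚ.* ε ℚ.+ ½ ℚ.* ε ≡ ε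
  half+half = solve 1 (λ ε → con ½ :* ε :+ con ½ :* ε := ε) refl
    where open +-*-Solver

  rearrange : ∀ a b c d →
    (a ℚ.+ b) ℚ.- (c ℚ.+ d) ≡ (a ℚ.- c) ℚ.+ (b ℚ.- d)
  rearrange = solve 4 (λ a b c d → (a :+ b) :- (c :+ d) := (a :- c) :+ (b :- d)) refl
    where open +-*-Solver

  +-cauchy : ∀ x y → Cauchy x → Cauchy y → Cauchy (λ n → x n ℚ.+ y n)
  +-cauchy x y cx cy ε 0<ε
    with cx (½ ℚ.* ε) (half-pos 0<ε) | cy (½ ℚ.* ε) (half-pos 0<ε)
  ... | M , hx | N , hy = M ℕ.⊔ N , λ m n m≥ n≥ → begin-strict
    ℚ.∣ (x m ℚ.+ y m) ℚ.- (x n ℚ.+ y n) ∣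
      ≡⟨ cong ℚ.∣_∣ (rearrange (x m) (y m) (x n) (y n)) ⟩
    ℚ.∣ (x m ℚ.- x n) ℚ.+ (y m ℚ.- y n) ∣
      ≤⟨ ℚ.∣p+q∣≤∣p∣+∣q∣ (x m ℚ.- x n) (y m ℚ.- y n) ⟩
    ℚ.∣ x m ℚ.- x n ∣ ℚ.+ ℚ.∣ y m ℚ.- y n ∣
      <⟨ ℚ.+-mono-<
           (hx m n (ℕ.m⊔n≤o⇒m≤o M N m≥) (ℕ.m⊔n≤o⇒m≤o M N n≥))
           (hy m n (ℕ.m⊔n≤o⇒n≤o M N m≥) (ℕ.m⊔n≤o⇒n≤o M N n≥)) ⟩
    ½ ℚ.* ε ℚ.+ ½ ℚ.* ε
      ≡⟨ half+half ε ⟩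
    ε ∎
    where open ℚ.≤-Reasoning

infixl 6 _+ℝ_

_+ℝ_ : ℝ → ℝ → ℝ
seq    (x +ℝ y) n = seq x n ℚ.+ seq y n
cauchy (x +ℝ y)   = +-cauchy (seq x) (seq y) (cauchy x) (cauchy y)

fromℚ : ℚ → ℝ
seq    (fromℚ q) _ = q
cauchy (fromℚ q) ε 0<ε =
  0 , λ _ _ _ _ → subst (ℚ._< ε) (cong ℚ.∣_∣ (sym (ℚ.+-inverseʳ q))) 0<ε

ℕ→ℝ : ℕ → ℝ
ℕ→ℝ n = fromℚ (ℤ.+ n / 1)

------------------------------------------------------------------------
-- The number systems in which flow functions may take their values

record Values : Set₁ where
  field
    rawMonoid : RawMonoid 0ℓ 0ℓ

  open RawMonoid rawMonoid public
    using (Carrier; _≈_) renaming (ε to 0#)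
  open RawMonoidDefinitions rawMonoid public using (sum)

  field
    _≤_   : Carrier → Carrier → Set
    _<_   : Carrier → Carrier → Set
    fromℕ : ℕ → Carrier

integral : Values
integral = record
  { rawMonoid = ℕ.+-0-rawMonoid
  ; _≤_       = ℕ._≤_
  ; _<_       = ℕ._<_
  ; fromℕ     = λ n → n
  }

real : Values
real = record
  { rawMonoid = record { Carrier = ℝ ; _≈_ = _≈ℝ_ ; _∙_ = _+ℝ_ ; ε = ℕ→ℝ 0 }
  ; _≤_       = _≤ℝ_
  ; _<_       = _<ℝ_
  ; fromℕ     = ℕ→ℝ
  }

------------------------------------------------------------------------
-- Flow networks with vertex set Fin n and atomic propositions Fin k.
-- succs u is the set of v such that (u , v) is an edge; membership in a
-- Subset is proof-irrelevant, so a function on proofs of u ⟶ v is a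
-- function on edges.

record Network (n k : ℕ) : Set where
  field
    source  : Fin n
    targets : Subset n
    succs   : Fin n → Subset n

  infix 4 _⟶_
  _⟶_ : Fin n → Fin n → Set
  u ⟶ v = v ∈ succs u

  field
    capacity : ∀ {u v} → u ⟶ v → ℕ
    label    : Fin n → Subset k

    source∉targets     : source ∉ targets
    edge-from∉targets  : ∀ {u v} → u ⟶ v → u ∉ targets
    edge-to≢source     : ∀ {u v} → u ⟶ v → v ≢ source
    targets-reachable  : ∀ {t} → t ∈ targets → Star _⟶_ source t
    reaches-target     : ∀ v → ∃ λ t → t ∈ targets × Star _⟶_ v t

module _ {n k : ℕ} (N : Network n k) where
  open Network N

  module _ (R : Values) where
    open Values R

    EdgeFunction : Set
    EdgeFunction = ∀ {u v} → u ⟶ v → Carrier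

    -- Extension by zero to pairs that are not edges, so that sums over
    -- edges can be taken over all vertices.
    extend : EdgeFunction → Fin n → Fin n → Carrier
    extend f u v with v ∈? succs u
    ... | yes e = f e
    ... | no  _ = 0#

    inflow outflow : EdgeFunction → Fin n → Carrier
    inflow  f v = sum (λ u → extend f u v)
    outflow f v = sum (λ w → extend f v w)

    record Flow : Set where
      field
        value        : EdgeFunction
        nonnegative  : ∀ {u v} (e : u ⟶ v) → 0# ≤ value e
        capacitated  : ∀ {u v} (e : u ⟶ v) → value e ≤ fromℕ (capacity e)
        conservation : ∀ v → v ≢ source → v ∉ targets →
                       inflow value v ≈ outflow value v

    vertexFlow : Flow → Fin n → Carrier
    vertexFlow f v with v Fin.≟ source
    ... | yes _ = outflow (Flow.value f) v
    ... | no  _ = inflow  (Flow.value f) v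

  data TargetPath : Fin n → Set where
    end  : ∀ {v} → v ∈ targets → TargetPath v
    step : ∀ {u v} → u ⟶ v → TargetPath v → TargetPath u

  length : ∀ {u} → TargetPath u → ℕ
  length (end _)    = 0
  length (step _ π) = ℕ.suc (length π)

  suffix : ∀ {u} (π : TargetPath u) → Fin (ℕ.suc (length π)) → Σ (Fin n) TargetPath
  suffix π          zero    = _ , π
  suffix (step _ π) (suc i) = suffix π i

------------------------------------------------------------------------
-- Syntax of BFL⋆ over atomic propositions Fin k

mutual
  data StateFormula (k : ℕ) : Set where
    atom   : Fin k → StateFormula k
    flow>_ : ℕ → StateFormula k
    flow≥_ : ℕ → StateFormula k
    not    : StateFormula k → StateFormula k
    _or_   : StateFormula k → StateFormula k → StateFormula k
    A      : PathFormula k → StateFormula k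
    𝓐      : StateFormula k → StateFormula k

  data PathFormula (k : ℕ) : Set where
    state : StateFormula k → PathFormula k
    not   : PathFormula k → PathFormula k
    _or_  : PathFormula k → PathFormula k → PathFormula k
    X     : PathFormula k → PathFormula k
    _U_   : PathFormula k → PathFormula k → PathFormula k

mutual
  Closed : ∀ {k} → StateFormula k → Set
  Closed (atom _)   = ⊤
  Closed (flow> _)  = ⊥
  Closed (flow≥ _)  = ⊥
  Closed (not φ)    = Closed φ
  Closed (φ₁ or φ₂) = Closed φ₁ × Closed φ₂
  Closed (A ψ)      = ClosedPath ψ
  Closed (𝓐 _)      = ⊤

  ClosedPath : ∀ {k} → PathFormula k → Set
  ClosedPath (state φ)  = Closed φ
  ClosedPath (not ψ)    = ClosedPath ψ
  ClosedPath (ψ₁ or ψ₂) = ClosedPath ψ₁ × ClosedPath ψ₂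
  ClosedPath (X ψ)      = ClosedPath ψ
  ClosedPath (ψ₁ U ψ₂)  = ClosedPath ψ₁ × ClosedPath ψ₂

------------------------------------------------------------------------
-- Semantics, with flow quantifiers ranging over R-valued flow functions.
-- Connectives are read as type formers; under excluded middle this is the
-- usual two-valued semantics.

module _ (R : Values) {n k : ℕ} (N : Network n k) where
  open Network N
  open Values R

  mutual
    Sat : Fin n → Flow N R → StateFormula k → Set
    Sat v f (atom p)   = p ∈ label v
    Sat v f (flow> γ)  = fromℕ γ < vertexFlow N R f v
    Sat v f (flow≥ γ)  = fromℕ γ ≤ vertexFlow N R f v
    Sat v f (not φ)    = ¬ Sat v f φ
    Sat v f (φ₁ or φ₂) = Sat v f φ₁ ⊎ Sat v f φ₂
    Sat v f (A ψ)      = ∀ (π : TargetPath N v) → SatPath π f ψ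
    Sat v f (𝓐 φ)      = ∀ (f′ : Flow N R) → Sat v f′ φ

    SatPath : ∀ {v} → TargetPath N v → Flow N R → PathFormula k → Set
    SatPath {v} π      f (state φ)  = Sat v f φ
    SatPath π          f (not ψ)    = ¬ SatPath π f ψ
    SatPath π          f (ψ₁ or ψ₂) = SatPath π f ψ₁ ⊎ SatPath π f ψ₂
    SatPath (end _)    f (X ψ)      = ⊥
    SatPath (step _ π) f (X ψ)      = SatPath π f ψ
    SatPath π          f (ψ₁ U ψ₂)  = ∃ λ j →
      SatPath (proj₂ (suffix N π j)) f ψ₂ ×
      (∀ i → i Fin.< j → SatPath (proj₂ (suffix N π i)) f ψ₁)

  -- For closed φ the flow function is irrelevant. Flow functions always
  -- exist (the zero flow), so quantifying universally over it is harmless.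
  Models : StateFormula k → Set
  Models φ = ∀ (f : Flow N R) → Sat source f φ

{-# OPTIONS --safe #-}

-- On a single edge of capacity 1 from the source to a target, the formula
-- 𝓐 (¬ (> 0) ∨ ≥ 1) says that every flow leaving the source is 0 or at
-- least 1: true for integral flows, refuted by the real flow ½.
module Submission where

open import Defs
open import Data.Empty using (⊥-elim)
open import Data.Fin using (zero; suc)
open import Data.Fin.Subset using (⁅_⁆; ⊥)
open import Data.Nat using (ℕ; zero; suc; z≤n; s≤s)
import Data.Nat as ℕ
import Data.Nat.Properties as ℕ
open import Data.Product using (Σ; Σ-syntax; ∃-syntax; _×_; _,_)
open import Data.Rational using (0ℚ; 1ℚ; ½)
import Data.Rational as ℚ
import Data.Rational.Properties as ℚ
open import Data.Sum using (_⊎_; inj₁; inj₂)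
open import Data.Unit using (tt)
open import Data.Vec using ([]; _∷_; here; there)
open import Relation.Binary.Construct.Closure.ReflexiveTransitive using (ε; _◅_)
open import Relation.Binary.PropositionalEquality using (refl; subst)
open import Relation.Nullary using (¬_)
open import Relation.Nullary.Decidable using (from-yes)

-- Both sequences are constant, so any slack `δ` makes the inequality strict from index 0 on.
fromℚ-mono-≤ : ∀ {p q} → p ℚ.≤ q → fromℚ p ≤ℝ fromℚ q
fromℚ-mono-≤ {p} {q} p≤q δ 0<δ =
  0 , λ _ _ → subst (ℚ._< q ℚ.+ δ) (ℚ.+-identityʳ p) (ℚ.+-mono-≤-< p≤q 0<δ)

singleEdge : Network 2 0
singleEdge = record
  { source            = zero
  ; targets           = ⁅ suc zero ⁆
  ; succs             = λ { zero → ⁅ suc zero ⁆ ; (suc zero) → ⊥ }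
  ; capacity          = λ _ → 1
  ; label             = λ _ → []
  ; source∉targets    = λ ()
  ; edge-from∉targets = λ { {zero} _ () ; {suc zero} (there (there ())) }
  ; edge-to≢source    = λ { {zero} () refl ; {suc zero} () refl }
  ; targets-reachable = λ { (there here) → there here ◅ ε }
  ; reaches-target    = λ { zero       → suc zero , there here , there here ◅ ε
                          ; (suc zero) → suc zero , there here , ε }
  }

halfFlow : Flow singleEdge real
halfFlow = record
  { value        = λ _ → fromℚ ½
  ; nonnegative  = λ _ → fromℚ-mono-≤ (from-yes (0ℚ ℚ.≤? ½))
  ; capacitated  = λ _ → fromℚ-mono-≤ (from-yes (½ ℚ.≤? 1ℚ))
  -- Vacuous: each of the two vertices is the source or a target.
  ; conservation = λ { zero v≢s _ → ⊥-elim (v≢s refl)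
                     ; (suc zero) _ v∉T → ⊥-elim (v∉T (there here)) }
  }

zeroOrAtLeastOne : StateFormula 0
zeroOrAtLeastOne = 𝓐 (not (flow> 0) or (flow≥ 1))

≯0⊎≥1 : ∀ m → ¬ (0 ℕ.< m) ⊎ 1 ℕ.≤ m
≯0⊎≥1 zero    = inj₁ λ ()
≯0⊎≥1 (suc m) = inj₂ (s≤s z≤n)

integral-models : Models integral singleEdge zeroOrAtLeastOne
integral-models _ f = ≯0⊎≥1 (vertexFlow singleEdge integral f zero)

real-not-models : ¬ Models real singleEdge zeroOrAtLeastOne
-- The first `halfFlow` is the outer flow, which a closed formula ignores; the second instantiates
-- `𝓐`. The outflow at the source then evaluates to ½ at every index.
real-not-models models with models halfFlow halfFlow
-- `_<ℝ_` asks for a positive gap, and ¼ fits strictly between 0 and ½.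
... | inj₁ ≯0 = ≯0 (¼ , from-yes (0ℚ ℚ.<? ¼) , 0 , λ _ _ → from-yes (0ℚ ℚ.+ ¼ ℚ.<? ½))
  where ¼ = ½ ℚ.* ½
-- Slack ½ is exactly the distance from ½ to 1, so the strict bound at index `M` reads 1 < 1.
... | inj₂ ≥1 with ≥1 ½ (from-yes (0ℚ ℚ.<? ½))
...   | M , 1<½+½ = ℚ.<-irrefl refl (1<½+½ M ℕ.≤-refl)

proposition3p1 : ∃[ n ] ∃[ k ] Σ[ N ∈ Network n k ] Σ[ φ ∈ StateFormula k ]
    (Closed φ ×
    ((Models integral N φ × ¬ Models real N φ) ⊎
    (¬ Models integral N φ × Models real N φ)))
proposition3p1 =
  2 , 0 , singleEdge , zeroOrAtLeastOne , tt , inj₁ (integral-models , real-not-models)
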